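{- For all integers $d\ge 1$ and $k\ge 3^{d-1}$, every finite $d$-degenerate graph has an equitable partition into $k$ induced forests.
   Context: A graph $G$ is $d$-degenerate if every subgraph of $G$ contains a vertex of degree at most $d$. An equitable partition of $G$ into $k$ parts is a partition of its vertex set into $k$ sets $S_1,\dots,S_k$ (some possibly empty) with $||S_i|-|S_j||\le 1$ for all $i,j$; it is a partition into induced forests if each part induces a forest (acyclic graph) in $G$. -}

module Defs where

open import Data.Nat using (ℕ; zero; suc; _+_; _≤_)
open import Data.Fin using (Fin; zero; suc; _≟_)
open import Data.Bool using (Bool; true; false; if_then_else_; _∧_)
open import Data.Product using (Σ; _×_; ∃; ∃-syntax)
open import Relation.Nullary using (¬_)
open import Relation.Nullary.Decidable using (⌊_⌋)
open import Relation.Binary.PropositionalEquality using (_≡_)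
open import Function.Definitions using (Injective)

count : ∀ {n} → (Fin n → Bool) → ℕ
count {zero}  p = 0
count {suc n} p = (if p zero then 1 else 0) + count (λ i → p (suc i))

record Graph : Set where
  field
    n     : ℕ
    adj   : Fin n → Fin n → Bool
    sym   : ∀ u v → adj u v ≡ adj v u
    irref : ∀ v → adj v v ≡ false
open Graph public

record Subgraph (G : Graph) : Set where
  field
    S      : Fin (n G) → Bool
    F      : Fin (n G) → Fin (n G) → Bool
    F-sym  : ∀ u v → F u v ≡ F v u
    F⊆E    : ∀ u v → F u v ≡ true → adj G u v ≡ true
    F⊆S    : ∀ u v → F u v ≡ true → S u ≡ true
open Subgraph public

degIn : {G : Graph} → Subgraph G → Fin (n G) → ℕ
degIn H v = count (λ u → F H v u)

Degenerate : ℕ → Graph → Set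
Degenerate d G = (H : Subgraph G) → ∃[ v ] S H v ≡ true →
  ∃[ v ] (S H v ≡ true × degIn H v ≤ d)

record CycleIn (G : Graph) (P : Fin (n G) → Bool) : Set where
  field
    m      : ℕ
    c      : Fin (suc (suc (suc m))) → Fin (n G)
    inj    : Injective _≡_ _≡_ c
    inP    : ∀ i → P (c i) ≡ true
    step   : ∀ (i : Fin (suc (suc m))) → adj G (c (Data.Fin.inject₁ i)) (c (suc i)) ≡ true
    close  : adj G (c (Data.Fin.fromℕ (suc (suc m)))) (c zero) ≡ true

InducesForest : (G : Graph) → (Fin (n G) → Bool) → Set
InducesForest G P = ¬ CycleIn G P

part : {G : Graph} {k : ℕ} → (Fin (n G) → Fin k) → Fin k → Fin (n G) → Bool
part f i v = ⌊ f v ≟ i ⌋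

-- equitable partition into k induced forests (parts may be empty)
EquitableForestPartition : (G : Graph) (k : ℕ) → Set
EquitableForestPartition G k = Σ (Fin (n G) → Fin k) λ f →
  (∀ i j → count (part {G} f i) ≤ count (part {G} f j) + 1)
  × (∀ i → InducesForest G (part {G} f i))

{-# OPTIONS --safe #-}
module Submission where

-- Fix an ordering in which every vertex has at most d earlier neighbours.  If d ≥ 2, choose two
-- earlier neighbours of every vertex that has them; a vertex and its two chosen neighbours form a
-- triple.  In a 3-colouring without monochromatic triples every vertex loses an earlier neighbour
-- in its own class, so the classes are (d−1)-degenerate.  Equitable such 3-colourings exist, and
-- iterating them gives 3^(d−1) forests.  For larger k, split off a forest with ⌊N/k⌋ vertices (each
-- of the 3^(d−1) forests is at least that large) and use induction on k.
--
-- For the equitable 3-colouring, add vertices one at a time, those that are last in no triple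
-- before the others.  The process is stuck only if there is
-- a single smallest class A and every w in the complement W of A completes a triple μ w inside
-- A ∪ {w}.  Write a for the size of A; there are 3(a+1) vertices, so at most a of them own a triple
-- other than the μ w.  Charge every triple that meets W to one of its vertices in W.  More than a
-- vertices w are charged for μ w only, hence two of them, w₁ and w₂, have a common u ∈ A in μ w₁
-- and μ w₂.  Then I = A − u + w₁ + w₂ contains no triple and has a+1 vertices, while its complement,
-- with 2(a+1) vertices, contains at most a triples.  A set with at
-- least twice as many vertices as triples stays so in the above order of addition, and then the
-- same process with two colours never gets stuck, because the μ w would be too many.

open import Defs
open import Data.Nat using (ℕ; _≤_; _∸_; _^_)
open import Data.Nat using (zero; suc; _+_; _*_; _<_; z≤n; s≤s; _≤?_; _<?_; pred)
open import Data.Nat.Properties hiding (_≟_; suc-injective)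
open import Data.Nat.DivMod using (_/_; _%_; m≡m%n+[m/n]*n; m%n<n; m/n*n≤m)
open import Data.Fin using (Fin; zero; suc; _≟_; inject₁; fromℕ; toℕ; combine)
open import Data.Fin.Properties using (any?; all?; suc-injective; combine-injective; combine-surjective)
open import Data.Bool using (Bool; true; false; if_then_else_)
import Data.Bool as Bool
import Data.Fin as Fin
import Data.Fin.Properties as Fin
open import Data.Fin.Relation.Unary.Top using (view; ‵fromℕ; ‵inject₁)
open import Data.Product using (_×_; ∃; ∃₂; _,_; proj₁; proj₂)
open import Data.Sum using (_⊎_; inj₁; inj₂; [_,_]′)
open import Data.Unit using (⊤; tt)
open import Function using (_∘_; id; const)
open import Relation.Nullary using (¬_; Dec; yes; no; contradiction)
open import Relation.Nullary.Decidable using (⌊_⌋; ¬?; _×-dec_; _⊎-dec_; decidable-stable)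
open import Relation.Binary.PropositionalEquality
  using (_≡_; _≢_; refl; trans; cong; cong₂; subst; subst₂; module ≡-Reasoning) renaming (sym to ≡-sym)
open import Data.Vec.Functional using (updateAt)
open import Data.Vec.Functional.Properties using (updateAt-updates; updateAt-minimal)
open import Algebra.Properties.CommutativeMonoid.Sum +-0-commutativeMonoid
  using (sum; sum-cong-≗; sum-replicate-zero; ∑-distrib-+)
open import Algebra.Properties.CommutativeSemigroup +-commutativeSemigroup using (interchange)

-- Finite sets as Boolean predicates

Sub : ℕ → Set
Sub N = Fin N → Bool

infix 4 _∈_ _∉_ _∈?_ _⊆_

_∈_ _∉_ : ∀ {N} → Fin N → Sub N → Set
v ∈ P = P v ≡ true
v ∉ P = ¬ v ∈ P

_∈?_ : ∀ {N} (v : Fin N) (P : Sub N) → Dec (v ∈ P)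
v ∈? P = P v Bool.≟ true

_⊆_ : ∀ {N} → Sub N → Sub N → Set
P ⊆ Q = ∀ v → v ∈ P → v ∈ Q

isYes⁺ : {A : Set} (A? : Dec A) → A → ⌊ A? ⌋ ≡ true
isYes⁺ (yes _) _ = refl
isYes⁺ (no ¬a) a = contradiction a ¬a

isYes⁻ : {A : Set} (A? : Dec A) → ⌊ A? ⌋ ≡ true → A
isYes⁻ (yes a) _ = a

by-cases : {A B : Set} → Dec A → (A → B) → (¬ A → B) → B
by-cases (yes a) f g = f a
by-cases (no ¬a) f g = g ¬a

∁-true : ∀ {x} → ¬ x ≡ true → x ≡ false
∁-true {true}  x≢ = contradiction refl x≢
∁-true {false} x≢ = refl

isYes-cong : {A B : Set} (A? : Dec A) (B? : Dec B) → (A → B) → (B → A) → ⌊ A? ⌋ ≡ ⌊ B? ⌋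
isYes-cong A? (yes b) f g = isYes⁺ A? (g b)
isYes-cong A? (no ¬b) f g = ∁-true λ p → ¬b (f (isYes⁻ A? p))

infixl 6 _∩_ _∖_ _⊝_ _⊕_

opaque

  _∩_ _∖_ : ∀ {N} → Sub N → {Q : Fin N → Set} → (∀ v → Dec (Q v)) → Sub N
  (P ∩ Q?) v = ⌊ (v ∈? P) ×-dec Q? v ⌋
  (P ∖ Q?) v = ⌊ (v ∈? P) ×-dec ¬? (Q? v) ⌋

  _⊕_ : ∀ {N} → Sub N → Fin N → Sub N
  (P ⊕ u) v = ⌊ (v ∈? P) ⊎-dec (v ≟ u) ⌋

_⊝_ : ∀ {N} → Sub N → Fin N → Sub N
P ⊝ u = P ∖ (_≟ u)

module _ {N} (P : Sub N) where

  module _ {Q : Fin N → Set} (Q? : ∀ v → Dec (Q v)) where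

    opaque
      unfolding _∩_

      ∩⁺ : ∀ {v} → v ∈ P → Q v → v ∈ P ∩ Q?
      ∩⁺ {v} p q = isYes⁺ ((v ∈? P) ×-dec Q? v) (p , q)

      ∩⁻ : ∀ {v} → v ∈ P ∩ Q? → v ∈ P × Q v
      ∩⁻ {v} = isYes⁻ ((v ∈? P) ×-dec Q? v)

      ∖⁺ : ∀ {v} → v ∈ P → ¬ Q v → v ∈ P ∖ Q?
      ∖⁺ {v} p q = isYes⁺ ((v ∈? P) ×-dec ¬? (Q? v)) (p , q)

      ∖⁻ : ∀ {v} → v ∈ P ∖ Q? → v ∈ P × ¬ Q v
      ∖⁻ {v} = isYes⁻ ((v ∈? P) ×-dec ¬? (Q? v))

  ⊝⁺ : ∀ {u v} → v ∈ P → v ≢ u → v ∈ P ⊝ u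
  ⊝⁺ {u} = ∖⁺ (_≟ u)

  ⊝⁻ : ∀ {u v} → v ∈ P ⊝ u → v ∈ P × v ≢ u
  ⊝⁻ {u} = ∖⁻ (_≟ u)

  opaque
    unfolding _⊕_

    ⊕⁺ : ∀ {u v} → v ∈ P ⊎ v ≡ u → v ∈ P ⊕ u
    ⊕⁺ {u} {v} = isYes⁺ ((v ∈? P) ⊎-dec (v ≟ u))

    ⊕⁻ : ∀ {u v} → v ∈ P ⊕ u → v ∈ P ⊎ v ≡ u
    ⊕⁻ {u} {v} = isYes⁻ ((v ∈? P) ⊎-dec (v ≟ u))

-- Cardinalities

ind : Bool → ℕ
ind b = if b then 1 else 0

ind-mono : ∀ {b c} → (b ≡ true → c ≡ true) → ind b ≤ ind c
ind-mono {false} _ = z≤n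
ind-mono {true} {true}  _ = ≤-refl
ind-mono {true} {false} f = contradiction (f refl) λ ()

count-⊆ : ∀ {N} (P Q : Sub N) → P ⊆ Q → count P ≤ count Q
count-⊆ {zero}  P Q _ = z≤n
count-⊆ {suc N} P Q s = +-mono-≤ (ind-mono (s zero)) (count-⊆ (P ∘ suc) (Q ∘ suc) (s ∘ suc))

count-cong : ∀ {N} (P Q : Sub N) → P ⊆ Q → Q ⊆ P → count P ≡ count Q
count-cong P Q s t = ≤-antisym (count-⊆ P Q s) (count-⊆ Q P t)

count-∅ : ∀ {N} {P : Sub N} → (∀ v → v ∉ P) → count P ≡ 0
count-∅ {zero}  _ = refl
count-∅ {suc N} {P} e rewrite ∁-true (e zero) = count-∅ (e ∘ suc)

nonempty : ∀ {N} (P : Sub N) → 0 < count P → ∃ λ v → v ∈ P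
nonempty P 0<P with any? (_∈? P)
... | yes p = p
... | no ¬p = contradiction 0<P (<-irrefl (≡-sym (count-∅ λ v p → ¬p (v , p))))

opaque
  unfolding _∩_

  count-split : ∀ {N} (P : Sub N) {Q : Fin N → Set} (Q? : ∀ v → Dec (Q v)) →
                count P ≡ count (P ∩ Q?) + count (P ∖ Q?)
  count-split {zero}  P Q? = refl
  count-split {suc N} P Q? =
    trans (cong₂ _+_ (head (P zero) (Q? zero)) (count-split (P ∘ suc) (Q? ∘ suc)))
          (interchange (ind ((P ∩ Q?) zero)) (ind ((P ∖ Q?) zero)) _ _)
    where
    head : ∀ {A : Set} b (A? : Dec A) →
           ind b ≡ ind ⌊ (b Bool.≟ true) ×-dec A? ⌋ + ind ⌊ (b Bool.≟ true) ×-dec ¬? A? ⌋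
    head false _       = refl
    head true  (yes _) = refl
    head true  (no _)  = refl

opaque
  unfolding _∩_

  count-⊝ : ∀ {N} (P : Sub N) u → u ∈ P → count P ≡ suc (count (P ⊝ u))
  count-⊝ {suc N} P zero u∈ rewrite u∈ =
    cong suc (count-cong (P ∘ suc) ((P ⊝ zero) ∘ suc)
      (λ v p → ⊝⁺ P {zero} {suc v} p λ ()) (λ v p → proj₁ (⊝⁻ P {zero} {suc v} p)))
  count-⊝ {suc N} P (suc u) u∈ = begin
    ind (P zero) + count (P ∘ suc)                  ≡⟨ cong₂ _+_ same (count-⊝ (P ∘ suc) u u∈) ⟩
    ind ((P ⊝ suc u) zero) + suc (count ((P ∘ suc) ⊝ u))  ≡⟨ +-suc _ _ ⟩
    suc (ind ((P ⊝ suc u) zero) + count ((P ∘ suc) ⊝ u))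
      ≡⟨ cong (λ z → suc (ind ((P ⊝ suc u) zero) + z)) (count-cong ((P ∘ suc) ⊝ u) ((P ⊝ suc u) ∘ suc)
           (λ v p → let q , v≢u = ⊝⁻ (P ∘ suc) p in ⊝⁺ P {suc u} {suc v} q (v≢u ∘ suc-injective))
           (λ v p → let q , v≢u = ⊝⁻ P {suc u} {suc v} p in ⊝⁺ (P ∘ suc) q (v≢u ∘ cong suc))) ⟩
    suc (count (P ⊝ suc u))                         ∎
    where
    open ≡-Reasoning
    same : ind (P zero) ≡ ind ((P ⊝ suc u) zero)
    same with P zero
    ... | true  = refl
    ... | false = refl

count-⊕ : ∀ {N} (P : Sub N) u → u ∉ P → count (P ⊕ u) ≡ suc (count P)
count-⊕ P u u∉ = trans (count-⊝ (P ⊕ u) u (⊕⁺ P (inj₂ refl)))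
  (cong suc (count-cong ((P ⊕ u) ⊝ u) P
    (λ v p → let q , v≢u = ⊝⁻ (P ⊕ u) p in [ id , (λ e → contradiction e v≢u) ]′ (⊕⁻ P q))
    (λ v p → ⊝⁺ (P ⊕ u) (⊕⁺ P (inj₁ p)) λ { refl → u∉ p })))

count-difference : ∀ {N} (P A : Sub N) → A ⊆ P → count P ≡ count A + count (P ∖ (_∈? A))
count-difference P A A⊆P = trans (count-split P (_∈? A)) (cong (_+ count (P ∖ (_∈? A)))
  (count-cong (P ∩ (_∈? A)) A (λ v → proj₂ ∘ ∩⁻ P (_∈? A)) (λ v a → ∩⁺ P (_∈? A) (A⊆P v a) a)))

count-⊂ : ∀ {N} (P Q : Sub N) u → P ⊆ Q → u ∈ Q → u ∉ P → count P < count Q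
count-⊂ P Q u P⊆Q u∈ u∉ rewrite count-⊝ Q u u∈ =
  s≤s (count-⊆ P (Q ⊝ u) λ v p → ⊝⁺ Q (P⊆Q v p) λ { refl → u∉ p })

-- Induction on the domain: if `zero` lies in `P`, then either another element of `P` has the same
-- image, or that image can be deleted from `Q` together with `zero` from `P`.
pigeonhole : ∀ {N M} (P : Sub N) (Q : Sub M) (φ : Fin N → Fin M) →
             (∀ v → v ∈ P → φ v ∈ Q) → count Q < count P →
             ∃₂ λ v w → v ∈ P × w ∈ P × v ≢ w × φ v ≡ φ w
pigeonhole {suc N} P Q φ into Q<P with P zero in P0
... | false = let v , w , v∈ , w∈ , v≢w , e = pigeonhole (P ∘ suc) Q (φ ∘ suc) (into ∘ suc) Q<P
              in suc v , suc w , v∈ , w∈ , v≢w ∘ suc-injective , e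
... | true with any? (λ v → (suc v ∈? P) ×-dec (φ (suc v) ≟ φ zero))
...   | yes (v , v∈ , e) = suc v , zero , v∈ , P0 , (λ ()) , e
...   | no none =
  let v , w , v∈ , w∈ , v≢w , e = pigeonhole (P ∘ suc) (Q ⊝ φ zero) (φ ∘ suc)
        (λ v v∈ → ⊝⁺ Q (into (suc v) v∈) λ e → none (v , v∈ , e))
        (≤-pred (subst (_< _) (count-⊝ Q (φ zero) (into zero P0)) Q<P))
  in suc v , suc w , v∈ , w∈ , v≢w ∘ suc-injective , e

count-inj : ∀ {N M} (P : Sub N) (Q : Sub M) (φ : Fin N → Fin M) → (∀ v → v ∈ P → φ v ∈ Q) →
            (∀ v w → v ∈ P → w ∈ P → φ v ≡ φ w → v ≡ w) → count P ≤ count Q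
count-inj P Q φ into inj = ≮⇒≥ λ Q<P →
  let v , w , v∈ , w∈ , v≢w , e = pigeonhole P Q φ into Q<P in v≢w (inj v w v∈ w∈ e)

-- Choice functions, subsets of prescribed size, extremal elements

choice : ∀ {N} (P : Sub N) {R : Fin N → Fin N → Set} → (∀ v → v ∈ P → ∃ (R v)) →
         ∃ λ (φ : Fin N → Fin N) → ∀ v → v ∈ P → R v (φ v)
choice P {R} f = (λ v → proj₁ (pick v)) , λ v → proj₂ (pick v)
  where
  pick : ∀ v → ∃ λ u → v ∈ P → R v u
  pick v with v ∈? P
  ... | yes p = let u , r = f v p in u , λ _ → r
  -- Outside `P` the chosen value is an arbitrary default.
  ... | no ¬p = v , λ p → contradiction p ¬p

two-elements : ∀ {N} (P : Sub N) → 2 ≤ count P → ∃₂ λ u v → u ≢ v × u ∈ P × v ∈ P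
two-elements P 2≤P =
  let u , u∈ = nonempty P (≤-trans (s≤s z≤n) 2≤P)
      v , v∈ = nonempty (P ⊝ u) (≤-pred (subst (2 ≤_) (count-⊝ P u u∈) 2≤P))
      v∈P , v≢u = ⊝⁻ P v∈
  in u , v , (λ e → v≢u (≡-sym e)) , u∈ , v∈P

two≤count : ∀ {N} (P : Sub N) {u v} → u ≢ v → u ∈ P → v ∈ P → 2 ≤ count P
two≤count P {u} {v} u≢v u∈ v∈ rewrite count-⊝ P u u∈
  | count-⊝ (P ⊝ u) v (⊝⁺ P v∈ λ e → u≢v (≡-sym e)) = s≤s (s≤s z≤n)

shrink : ∀ {N} (P : Sub N) e q → count P ≡ e + q → ∃ λ T → T ⊆ P × count T ≡ q
shrink P zero    q eq = P , (λ _ p → p) , eq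
shrink P (suc e) q eq =
  let u , u∈ = nonempty P (subst (0 <_) (≡-sym eq) (s≤s z≤n))
      T , T⊆ , T# = shrink (P ⊝ u) e q (cong pred (trans (≡-sym (count-⊝ P u u∈)) eq))
  in T , (λ v t → proj₁ (⊝⁻ P (T⊆ v t))) , T#

-- An arbitrary total preorder is allowed, so that reversing the order turns this maximum into the
-- minimum that `argmin` needs.
extremum : ∀ {N} {_≼_ : Fin N → Fin N → Set} → (∀ u v → u ≼ v ⊎ v ≼ u) →
           (∀ {u v w} → u ≼ v → v ≼ w → u ≼ w) →
           (P : Sub N) → ∃ (_∈ P) → ∃ λ v → v ∈ P × (∀ u → u ∈ P → u ≼ v)
extremum {suc N} {_≼_} total ≼-trans P (w , w∈) with any? (λ v → suc v ∈? P)
... | no ¬p = zero , 0∈ w w∈ , below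
  where
  0∈ : ∀ w → w ∈ P → zero ∈ P
  0∈ zero    p = p
  0∈ (suc w) p = contradiction (w , p) ¬p
  below : ∀ u → u ∈ P → u ≼ zero
  below zero    _ = [ id , id ]′ (total zero zero)
  below (suc u) p = contradiction (u , p) ¬p
... | yes p with extremum (λ u v → total (suc u) (suc v)) ≼-trans (P ∘ suc) p
...   | m , m∈ , max with zero ∈? P
...     | no 0∉ = suc m , m∈ , λ { zero p → contradiction p 0∉ ; (suc u) p → max u p }
...     | yes 0∈ with total zero (suc m)
...       | inj₁ 0≼m = suc m , m∈ , λ { zero _ → 0≼m ; (suc u) p → max u p }
...       | inj₂ m≼0 = zero , 0∈ ,
            λ { zero _ → [ id , id ]′ (total zero zero) ; (suc u) p → ≼-trans (max u p) m≼0 }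

argmax : ∀ {N} (g : Fin N → ℕ) (P : Sub N) → ∃ (_∈ P) → ∃ λ v → v ∈ P × (∀ u → u ∈ P → g u ≤ g v)
argmax g = extremum (λ u v → ≤-total (g u) (g v)) ≤-trans

argmin : ∀ {N} (g : Fin (suc N) → ℕ) → ∃ λ v → ∀ u → g v ≤ g u
argmin g =
  let v , _ , min = extremum {_≼_ = λ u v → g v ≤ g u} (λ u v → ≤-total (g v) (g u))
                      (λ p q → ≤-trans q p) (const true) (zero , refl)
  in v , λ u → min u refl

-- Sizes of colour classes

sum-≤ : ∀ {k} {g : Fin k → ℕ} q → (∀ i → g i ≤ q) → sum g ≤ k * q
sum-≤ {zero}  q h = z≤n
sum-≤ {suc k} q h = +-mono-≤ (h zero) (sum-≤ q (h ∘ suc))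

sum-≥ : ∀ {k} {g : Fin k → ℕ} q → (∀ i → q ≤ g i) → k * q ≤ sum g
sum-≥ {zero}  q h = z≤n
sum-≥ {suc k} q h = +-mono-≤ (h zero) (sum-≥ q (h ∘ suc))

sum-< : ∀ {k} {g : Fin k → ℕ} q i → (∀ j → g j ≤ q) → g i < q → sum g < k * q
sum-< {suc k} q zero    h l = +-mono-<-≤ l (sum-≤ q (h ∘ suc))
sum-< {suc k} q (suc i) h l = +-mono-≤-< (h zero) (sum-< q i (h ∘ suc) l)

sum-> : ∀ {k} {g : Fin k → ℕ} q i → (∀ j → q ≤ g j) → q < g i → k * q < sum g
sum-> {suc k} q zero    h l = +-mono-<-≤ l (sum-≥ q (h ∘ suc))
sum-> {suc k} q (suc i) h l = +-mono-≤-< (h zero) (sum-> q i (h ∘ suc) l)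

class : ∀ {N k} → Sub N → (Fin N → Fin k) → Fin k → Sub N
class P f i = P ∩ (λ v → f v ≟ i)

module _ {N k} {P : Sub N} {f : Fin N → Fin k} {i : Fin k} where

  class⁺ : ∀ {v} → v ∈ P → f v ≡ i → v ∈ class P f i
  class⁺ = ∩⁺ P (λ v → f v ≟ i)

  class⁻ : ∀ {v} → v ∈ class P f i → v ∈ P × f v ≡ i
  class⁻ = ∩⁻ P (λ v → f v ≟ i)

sum-indicator : ∀ {k} b (c : Fin k) → sum (λ i → ind ⌊ (b Bool.≟ true) ×-dec (c ≟ i) ⌋) ≡ ind b
sum-indicator {k} false c = sum-replicate-zero k
sum-indicator {suc k} true zero = cong suc (sum-replicate-zero k)
sum-indicator true (suc c) = trans
  (sum-cong-≗ λ i → cong ind (isYes-cong ((true Bool.≟ true) ×-dec (suc c ≟ suc i))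
    ((true Bool.≟ true) ×-dec (c ≟ i))
    (λ (p , e) → p , suc-injective e) λ (p , e) → p , cong suc e))
  (sum-indicator true c)

opaque
  unfolding _∩_

  count-classes : ∀ {N k} (P : Sub N) (f : Fin N → Fin k) → count P ≡ sum (λ i → count (class P f i))
  count-classes {zero}  {k} P f = ≡-sym (sum-replicate-zero k)
  count-classes {suc N} P f = trans
    (cong₂ _+_ (≡-sym (sum-indicator (P zero) (f zero))) (count-classes (P ∘ suc) (f ∘ suc)))
    (≡-sym (∑-distrib-+ (λ i → ind (class P f i zero)) (λ i → count (class (P ∘ suc) (f ∘ suc) i))))

Equitable : ∀ {N k} → Sub N → (Fin N → Fin k) → Set
Equitable P f = ∀ i j → count (class P f i) ≤ suc (count (class P f j))

constant-size : ∀ {N k} {P : Sub N} {f : Fin N → Fin k} {q} →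
                (∀ i → count (class P f i) ≡ q) → count P ≡ k * q
constant-size {P = P} {f} {q} h = trans (count-classes P f)
  (≤-antisym (sum-≤ q λ i → ≤-reflexive (h i)) (sum-≥ q λ i → ≤-reflexive (≡-sym (h i))))

module _ {N k} {P : Sub N} {f : Fin N → Fin k} (equi : Equitable P f) where

  -- A class with more than `q` elements would force every other class to have at least `q`, and the
  -- sum would exceed `k * q`. The lower bound that follows is dual.
  equitable-≤ : ∀ q → count P ≤ k * q → ∀ i → count (class P f i) ≤ q
  equitable-≤ q P≤ i = ≮⇒≥ λ q<i → <⇒≱
    (subst (k * q <_) (≡-sym (count-classes P f)) (sum-> q i (λ j → ≤-pred (≤-trans q<i (equi i j))) q<i)) P≤

  equitable-≥ : ∀ q → k * q ≤ count P → ∀ i → q ≤ count (class P f i)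
  equitable-≥ q ≤P i = ≮⇒≥ λ i<q → <⇒≱
    (subst (_< k * q) (≡-sym (count-classes P f)) (sum-< q i (λ j → ≤-trans (equi j i) i<q) i<q)) ≤P

-- Serves to colour a new vertex, to move a vertex to another class and, with `g = f`, to compare
-- class sizes before and after a deletion.
module Recolour {N k} (P : Sub N) (x : Fin N) (x∈P : x ∈ P) (f g : Fin N → Fin k)
                (agree : ∀ v → v ≢ x → g v ≡ f v) where

  ⊆-old : ∀ {j v} → v ≢ x → v ∈ class P g j → v ∈ class (P ⊝ x) f j
  ⊆-old v≢x v∈ = let p , e = class⁻ v∈ in class⁺ (⊝⁺ P p v≢x) (trans (≡-sym (agree _ v≢x)) e)

  old-⊆ : ∀ {j v} → v ∈ class (P ⊝ x) f j → v ∈ class P g j × v ≢ x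
  old-⊆ v∈ = let p , e = class⁻ v∈ ; q , v≢x = ⊝⁻ P p in class⁺ q (trans (agree _ v≢x) e) , v≢x

  size-new : ∀ j → g x ≡ j → count (class P g j) ≡ suc (count (class (P ⊝ x) f j))
  size-new j gx = trans (count-⊝ (class P g j) x (class⁺ x∈P gx))
    (cong suc (count-cong (class P g j ⊝ x) (class (P ⊝ x) f j)
      (λ v p → let q , v≢x = ⊝⁻ (class P g j) p in ⊆-old v≢x q)
      (λ v p → let q , v≢x = old-⊆ p in ⊝⁺ (class P g j) q v≢x)))

  size-other : ∀ j → g x ≢ j → count (class P g j) ≡ count (class (P ⊝ x) f j)
  size-other j gx≢j = count-cong (class P g j) (class (P ⊝ x) f j)
    (λ v p → ⊆-old (λ { refl → gx≢j (proj₂ (class⁻ p)) }) p)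
    (λ v p → proj₁ (old-⊆ p))

module AddColour {N k} (P I : Sub N) (I⊆P : I ⊆ P) (g : Fin N → Fin k) where

  J : Sub N
  J = P ∖ (_∈? I)

  h : Fin N → Fin (suc k)
  h v with v ∈? I
  ... | yes _ = zero
  ... | no _  = suc (g v)

  class-zero : class P h zero ⊆ I
  class-zero v v∈ with v ∈? I | proj₂ (class⁻ {f = h} v∈)
  ... | yes p | _ = p

  class-zero⁻¹ : I ⊆ class P h zero
  class-zero⁻¹ v v∈I = class⁺ (I⊆P v v∈I) eq
    where
    eq : h v ≡ zero
    eq with v ∈? I
    ... | yes _ = refl
    ... | no ¬p = contradiction v∈I ¬p

  class-suc : ∀ i → class P h (suc i) ⊆ class J g i
  class-suc i v v∈ with v ∈? I | class⁻ {f = h} v∈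
  ... | no ¬p | p , e = class⁺ (∖⁺ P (_∈? I) p ¬p) (Fin.suc-injective e)

  class-suc⁻¹ : ∀ i → class J g i ⊆ class P h (suc i)
  class-suc⁻¹ i v v∈ with class⁻ {P = J} v∈
  ... | v∈J , e with ∖⁻ P (_∈? I) v∈J
  ...   | p , ∉I = class⁺ p eq
    where
    eq : h v ≡ suc i
    eq with v ∈? I
    ... | yes q = contradiction q ∉I
    ... | no _  = cong suc e

  size-zero : count (class P h zero) ≡ count I
  size-zero = count-cong (class P h zero) I class-zero class-zero⁻¹

  size-suc : ∀ i → count (class P h (suc i)) ≡ count (class J g i)
  size-suc i = count-cong (class P h (suc i)) (class J g i) (class-suc i) (class-suc⁻¹ i)

-- Equitable colourings without monochromatic triples

-- A vertex v ∈ E owns the triple at v 0, at v 1, at v 2.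
module Triples {N} (E : Sub N) (at : Fin N → Fin 3 → Fin N) (rank : Fin N → ℕ)
  (at-zero : ∀ v → at v zero ≡ v)
  (at-injective : ∀ v → v ∈ E → ∀ {s t} → at v s ≡ at v t → s ≡ t)
  (at-earlier : ∀ v → v ∈ E → ∀ t → rank (at v (suc t)) < rank v) where

  opaque

    -- Each triple is represented by its owner, so that counting triples is counting vertices.
    edges : Sub N → Sub N
    edges P = E ∩ (λ v → all? λ t → at v t ∈? P)

    edges⁺ : ∀ P {v} → v ∈ E → (∀ t → at v t ∈ P) → v ∈ edges P
    edges⁺ P = ∩⁺ E (λ v → all? λ t → at v t ∈? P)

    edges⁻ : ∀ P {v} → v ∈ edges P → v ∈ E × (∀ t → at v t ∈ P)
    edges⁻ P = ∩⁻ E (λ v → all? λ t → at v t ∈? P)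

  edges-⊆ : ∀ P Q → P ⊆ Q → edges P ⊆ edges Q
  edges-⊆ P Q P⊆Q v v∈ = let e , all = edges⁻ P v∈ in edges⁺ Q e λ t → P⊆Q _ (all t)

  edges-self : ∀ P {v} → v ∈ edges P → v ∈ P
  edges-self P {v} v∈ = subst (_∈ P) (at-zero v) (proj₂ (edges⁻ P v∈) zero)

  Independent : Sub N → Set
  Independent P = ∀ v → v ∉ edges P

  record Colouring (P : Sub N) (k : ℕ) : Set where
    field
      f         : Fin N → Fin k
      proper    : ∀ i → Independent (class P f i)
      equitable : Equitable P f

  -- Colouring `x` after the rest of `P` can complete no triple but the one that `x` owns.
  record Fresh (P : Sub N) (x : Fin N) : Set where
    field
      x∈P    : x ∈ P
      unique : ∀ v t → v ∈ edges P → at v t ≡ x → v ≡ x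

  -- What is left when adding a vertex fails: `A` is the only smallest class and all others have one
  -- vertex more. The added vertex, still uncoloured, makes up the difference in `size` and is
  -- itself one of the blocked `w`.
  record Stuck (P : Sub N) (k : ℕ) : Set where
    field
      A           : Sub N
      A⊆P         : A ⊆ P
      independent : Independent A
      size        : count P ≡ k * suc (count A)
      blocked     : ∀ w → w ∈ P → w ∉ A → ∃ λ v → v ∈ edges (A ⊕ w)

  constant⇒equitable : ∀ {k P} {f : Fin N → Fin k} {q} → (∀ i → count (class P f i) ≡ q) → Equitable P f
  constant⇒equitable h i j rewrite h i | h j = n≤1+n _

  -- Adding one fresh vertex to an equitable colouring

  module Step {k P x} (fresh : Fresh P x) (c : Colouring (P ⊝ x) (suc k)) where
    open Fresh fresh
    open Colouring c

    rest : Sub N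
    rest = P ⊝ x

    size : Fin (suc k) → ℕ
    size i = count (class rest f i)

    edge-through-x : ∀ {g : Fin N → Fin (suc k)} {h} → (∀ v → v ≢ x → h v ≡ g v) → ∀ j v →
                     v ∈ edges (class P h j) → v ≡ x ⊎ v ∈ edges (class rest g j)
    edge-through-x {g} {h} agree j v v∈ with any? (λ t → at v t ≟ x)
    ... | yes (t , e) = inj₁ (unique v t (edges-⊆ (class P h j) P (λ _ → proj₁ ∘ class⁻) v v∈) e)
    ... | no ¬x = inj₂ (let e , all = edges⁻ (class P h j) v∈ in
      edges⁺ (class rest g j) e λ t → Recolour.⊆-old P x x∈P g h agree (λ e → ¬x (t , e)) (all t))

    put : Fin (suc k) → Fin N → Fin (suc k)
    put i = updateAt f x (const i)

    put-x : ∀ i → put i x ≡ i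
    put-x i = updateAt-updates x f

    put-other : ∀ i v → v ≢ x → put i v ≡ f v
    put-other i v v≢x = updateAt-minimal v x f v≢x

    module Put i = Recolour P x x∈P f (put i) (put-other i)

    Blocked : Fin (suc k) → Set
    Blocked i = x ∈ edges (class P (put i) i)

    second : Fin N
    second = at x (suc zero)

    second≢x : ∀ Q → x ∈ edges Q → second ≢ x
    second≢x Q x∈ e with at-injective x (proj₁ (edges⁻ Q x∈)) (trans e (≡-sym (at-zero x)))
    ... | ()

    -- Hence at most one colour is blocked for x.
    second-colour : ∀ {i} → Blocked i → f second ≡ i
    second-colour {i} b = trans (≡-sym (put-other i _ (second≢x (class P (put i) i) b)))
      (proj₂ (class⁻ {P = P} (proj₂ (edges⁻ (class P (put i) i) b) (suc zero))))

    place : ∀ i → ¬ Blocked i → (∀ j → size i ≤ size j) → Colouring P (suc k)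
    place i ¬b min = record { f = put i ; proper = prop ; equitable = equi }
      where
      prop : ∀ j → Independent (class P (put i) j)
      prop j v v∈ with edge-through-x (put-other i) j v v∈
      ... | inj₂ old = proper j v old
      ... | inj₁ refl with trans (≡-sym (put-x i)) (proj₂ (class⁻ {P = P} (edges-self (class P (put i) j) v∈)))
      ...   | refl = ¬b v∈
      new : ∀ j → i ≡ j → count (class P (put i) j) ≡ suc (size j)
      new j e = Put.size-new i j (trans (put-x i) e)
      other : ∀ j → i ≢ j → count (class P (put i) j) ≡ size j
      other j ne = Put.size-other i j λ e → ne (trans (≡-sym (put-x i)) e)
      equi : Equitable P (put i)
      equi a b with i ≟ a | i ≟ b
      ... | yes p | yes q rewrite new a p | new b q = s≤s (equitable a b)
      ... | yes p | no q rewrite new a p | other b q = s≤s (subst (λ z → size z ≤ size b) p (min b))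
      ... | no p | yes q rewrite other a p | new b q = m≤n⇒m≤1+n (equitable a b)
      ... | no p | no q rewrite other a p | other b q = equitable a b

    module _ {i₀} (x-blocked : Blocked i₀) (others : ∀ j → j ≢ i₀ → size j ≡ suc (size i₀)) where

      A : Sub N
      A = class rest f i₀

      -- The vertex `w` goes over to `A`, and `x` takes its place in the old class of `w`. Only `A`
      -- grows, and all classes end up with `suc (size i₀)` vertices.
      move : ∀ w → w ∈ rest → f w ≢ i₀ → (∀ v → v ∉ edges (A ⊕ w)) → Colouring P (suc k)
      move w w∈ fw≢ free = record
        { f = h ; proper = prop ; equitable = constant⇒equitable {P = P} sizes }
        where
        g h : Fin N → Fin (suc k)
        g = updateAt f w (const i₀)
        h = updateAt g x (const (f w))
        g-w : g w ≡ i₀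
        g-w = updateAt-updates w f
        h-x : h x ≡ f w
        h-x = updateAt-updates x g
        g-other : ∀ v → v ≢ w → g v ≡ f v
        g-other v = updateAt-minimal v w f
        h-other : ∀ v → v ≢ x → h v ≡ g v
        h-other v = updateAt-minimal v x g
        module H = Recolour P x x∈P g h h-other
        module G = Recolour rest w w∈ f g g-other
        module F = Recolour rest w w∈ f f (λ _ _ → refl)
        sizes : ∀ j → count (class P h j) ≡ suc (size i₀)
        sizes j with f w ≟ j
        ... | yes refl = begin
          count (class P h j)               ≡⟨ H.size-new j h-x ⟩
          suc (count (class rest g j))      ≡⟨ cong suc (G.size-other j λ e → fw≢ (trans (≡-sym e) g-w)) ⟩
          suc (count (class (rest ⊝ w) f j)) ≡⟨ F.size-new j refl ⟨
          size j                            ≡⟨ others j fw≢ ⟩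
          suc (size i₀)                     ∎
          where open ≡-Reasoning
        ... | no fw≢j with i₀ ≟ j
        ...   | yes refl = trans (H.size-other j λ e → fw≢j (trans (≡-sym h-x) e))
                (trans (G.size-new j g-w) (cong suc (≡-sym (F.size-other j fw≢j))))
        ...   | no i₀≢j = trans (H.size-other j λ e → fw≢j (trans (≡-sym h-x) e))
                (trans (G.size-other j λ e → i₀≢j (trans (≡-sym g-w) e))
                  (trans (≡-sym (F.size-other j fw≢j)) (others j λ e → i₀≢j (≡-sym e))))
        prop : ∀ j → Independent (class P h j)
        prop j v v∈ with edge-through-x h-other j v v∈
        -- A triple owned by `x` inside its new class would give `second` the colour `f w`. But
        -- `second` has colour `i₀`: it had this colour under `f`, because `x` is blocked there, and
        -- the only other change moves `w` to `i₀`.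
        ... | inj₁ refl = fw≢ (trans (≡-sym h-x) (trans (proj₂ (class⁻ {P = P} (edges-self (class P h j) v∈)))
                (trans (≡-sym (proj₂ (class⁻ {P = P} (proj₂ (edges⁻ (class P h j) v∈) (suc zero)))))
                  (trans (h-other _ (second≢x (class P (put i₀) i₀) x-blocked)) g-second))))
          where
          g-second : g second ≡ i₀
          g-second with second ≟ w
          ... | yes e = trans (cong g e) g-w
          ... | no ne = trans (g-other _ ne) (second-colour x-blocked)
        ... | inj₂ old with i₀ ≟ j
        ...   | yes refl = free v (edges-⊆ (class rest g j) (A ⊕ w) sub v old)
          where
          sub : class rest g j ⊆ A ⊕ w
          sub u u∈ = let p , e = class⁻ {P = rest} u∈ in
            by-cases (u ≟ w) (λ e → ⊕⁺ A (inj₂ e))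
              λ ne → ⊕⁺ A (inj₁ (class⁺ p (trans (≡-sym (g-other u ne)) e)))
        ...   | no i₀≢j = proper j v (edges-⊆ (class rest g j) (class rest f j) sub v old)
          where
          sub : class rest g j ⊆ class rest f j
          sub u u∈ with class⁻ {P = rest} u∈
          ... | p , e = class⁺ p (trans (≡-sym (g-other u λ { refl → i₀≢j (trans (≡-sym g-w) e) })) e)

      stuck : (∀ w → w ∈ rest → f w ≢ i₀ → ∃ λ v → v ∈ edges (A ⊕ w)) → Stuck P (suc k)
      stuck immovable = record
        { A = A
        ; A⊆P = λ v v∈ → proj₁ (⊝⁻ P (proj₁ (class⁻ v∈)))
        ; independent = proper i₀
        ; size = constant-size {P = P} sizes
        ; blocked = bl
        }
        where
        -- The improper colouring that puts `x` into `A` has classes of equal size, which gives the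
        -- size of `P`.
        sizes : ∀ j → count (class P (put i₀) j) ≡ suc (size i₀)
        sizes j with i₀ ≟ j
        ... | yes refl = Put.size-new i₀ j (put-x i₀)
        ... | no ne = trans (Put.size-other i₀ j λ e → ne (trans (≡-sym (put-x i₀)) e))
                            (others j λ e → ne (≡-sym e))
        bl : ∀ w → w ∈ P → w ∉ A → ∃ λ v → v ∈ edges (A ⊕ w)
        bl w w∈ w∉A with w ≟ x
        ... | no w≢x = let w∈rest = ⊝⁺ P w∈ w≢x in immovable w w∈rest λ e → w∉A (class⁺ w∈rest e)
        ... | yes refl = x , edges-⊆ (class P (put i₀) i₀) (A ⊕ x) sub x x-blocked
          where
          sub : class P (put i₀) i₀ ⊆ A ⊕ x
          sub u u∈ = by-cases (u ≟ x) (λ e → ⊕⁺ A (inj₂ e)) λ ne → ⊕⁺ A (inj₁ (Put.⊆-old i₀ ne u∈))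

    step : Colouring P (suc k) ⊎ Stuck P (suc k)
    step with argmin size
    ... | i₀ , min with x ∈? edges (class P (put i₀) i₀)
    ...   | no ¬b = inj₁ (place i₀ ¬b min)
    ...   | yes b with any? (λ j → ¬? (j ≟ i₀) ×-dec (size j ≤? size i₀))
    -- The minimal size is attained twice; since at most one colour is blocked, the second minimal
    -- colour is free.
    ...     | yes (j , j≢ , le) = inj₁ (place j
                (λ b′ → j≢ (trans (≡-sym (second-colour b′)) (second-colour b))) λ a → ≤-trans le (min a))
    ...     | no none with any? (λ w → (w ∈? rest) ×-dec ¬? (f w ≟ i₀) ×-dec
                                 ¬? (any? λ v → v ∈? edges (class rest f i₀ ⊕ w)))
    ...       | yes (w , w∈ , fw≢ , free) = inj₁ (move b others w w∈ fw≢ λ v v∈ → free (v , v∈))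
      where
      others : ∀ j → j ≢ i₀ → size j ≡ suc (size i₀)
      others j j≢ = ≤-antisym (equitable j i₀) (≰⇒> λ le → none (j , j≢ , le))
    ...       | no immovable = inj₂ (stuck b others λ w w∈ fw≢ →
                  decidable-stable (any? λ v → v ∈? edges (class rest f i₀ ⊕ w)) λ free → immovable (w , w∈ , fw≢ , free))
      where
      others : ∀ j → j ≢ i₀ → size j ≡ suc (size i₀)
      others j j≢ = ≤-antisym (equitable j i₀) (≰⇒> λ le → none (j , j≢ , le))

  -- In a triple the owner comes last, so the latest owner lies in no triple of another vertex of
  -- `P`. The final alternative records that deleting `x` destroys a triple unless none is left,
  -- which is what keeps a bound on the number of triples hereditary.
  fresh-vertex : ∀ P → ∃ (_∈ P) → ∃ λ x → Fresh P x × (x ∈ edges P ⊎ Independent P)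
  fresh-vertex P (w , w∈) with any? (_∈? edges P)
  ... | no none = w , record { x∈P = w∈ ; unique = λ v _ v∈ _ → contradiction (v , v∈) none } ,
                  inj₂ λ v v∈ → none (v , v∈)
  ... | yes some with argmax rank (edges P) some
  ...   | x , x∈ , max = x , record { x∈P = edges-self P x∈ ; unique = unique } , inj₁ x∈
    where
    unique : ∀ v t → v ∈ edges P → at v t ≡ x → v ≡ x
    unique v zero    v∈ e = trans (≡-sym (at-zero v)) e
    unique v (suc t) v∈ e = contradiction (max v v∈)
      (<⇒≱ (subst (λ z → rank z < rank v) e (at-earlier v (proj₁ (edges⁻ P v∈)) t)))

  -- `Q` is an invariant of the order of addition: trivial for three colours, a bound on the number
  -- of triples for two.
  module _ {k} (Q : Sub N → Set)
    (hereditary : ∀ P x → Q P → Fresh P x → x ∈ edges P ⊎ Independent P → Q (P ⊝ x))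
    (unstick : ∀ P → Q P → Stuck P (suc k) → Colouring P (suc k)) where

    colour-by-size : ∀ s P → count P ≡ s → Q P → Colouring P (suc k)
    colour-by-size zero P P# q = record
      { f = const zero
      ; proper = λ i v v∈ → empty v (proj₁ (class⁻ {i = i} (edges-self (class P (const zero) i) v∈)))
      ; equitable = constant⇒equitable {P = P} λ i → count-∅ λ v v∈ → empty v (proj₁ (class⁻ {i = i} v∈))
      }
      where
      empty : ∀ v → v ∉ P
      empty v v∈ with trans (≡-sym P#) (count-⊝ P v v∈)
      ... | ()
    colour-by-size (suc s) P P# q
      with x , fresh , e ← fresh-vertex P (nonempty P (subst (0 <_) (≡-sym P#) (s≤s z≤n)))
      with Step.step fresh (colour-by-size s (P ⊝ x)
             (cong pred (trans (≡-sym (count-⊝ P x (Fresh.x∈P fresh))) P#)) (hereditary P x q fresh e))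
    ... | inj₁ c = c
    ... | inj₂ stuck = unstick P q stuck

    colour : ∀ P → Q P → Colouring P (suc k)
    colour P = colour-by-size (count P) P refl

  -- Structure of stuck sets

  module Stuckness {P k} (s : Stuck P k) where
    open Stuck s public

    W : Sub N
    W = P ∖ (_∈? A)

    W⁻ : ∀ {v} → v ∈ W → v ∈ P × v ∉ A
    W⁻ = ∖⁻ P (_∈? A)

    size-W : count P ≡ count A + count W
    size-W = count-difference P A A⊆P

    chosen : ∃ λ (μ : Fin N → Fin N) → ∀ w → w ∈ W → μ w ∈ edges (A ⊕ w)
    chosen = choice W λ w w∈ → let p , ¬a = W⁻ w∈ in blocked w p ¬a

    μ : Fin N → Fin N
    μ = proj₁ chosen

    μ-edge : ∀ {w} → w ∈ W → μ w ∈ edges (A ⊕ w)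
    μ-edge = proj₂ chosen _

    μ∈E : ∀ {w} → w ∈ W → μ w ∈ E
    μ∈E {w} w∈ = proj₁ (edges⁻ (A ⊕ w) (μ-edge w∈))

    μ-vertex : ∀ {w} → w ∈ W → ∀ t → at (μ w) t ∈ A ⊎ at (μ w) t ≡ w
    μ-vertex {w} w∈ t = ⊕⁻ A (proj₂ (edges⁻ (A ⊕ w) (μ-edge w∈)) t)

    μ-edges-P : ∀ {w} → w ∈ W → μ w ∈ edges P
    μ-edges-P {w} w∈ = edges-⊆ (A ⊕ w) P
      (λ v v∈ → [ A⊆P v , (λ { refl → proj₁ (W⁻ w∈) }) ]′ (⊕⁻ A v∈)) (μ w) (μ-edge w∈)

    leaves-A : ∀ {v} → v ∈ E → ∃ λ t → at v t ∉ A
    leaves-A {v} v∈E with any? (λ t → ¬? (at v t ∈? A))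
    ... | yes found = found
    ... | no none = contradiction
      (edges⁺ A v∈E λ t → decidable-stable (at v t ∈? A) λ ∉A → none (t , ∉A)) (independent v)

    μ-contains : ∀ {w} → w ∈ W → ∃ λ t → at (μ w) t ≡ w
    μ-contains w∈ = let t , ∉A = leaves-A (μ∈E w∈) in
      t , [ (λ a → contradiction a ∉A) , id ]′ (μ-vertex w∈ t)

    -- All vertices of the triple of `μ w` other than `w` lie in `A`, so the triple determines `w`.
    μ-injective : ∀ v w → v ∈ W → w ∈ W → μ v ≡ μ w → v ≡ w
    μ-injective v w v∈ w∈ e with μ-contains v∈
    ... | t , at≡v with subst (λ u → at u t ∈ A ⊎ at u t ≡ w) (≡-sym e) (μ-vertex w∈ t)
    ...   | inj₁ a = contradiction (subst (_∈ A) at≡v a) (proj₂ (W⁻ v∈))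
    ...   | inj₂ at≡w = trans (≡-sym at≡v) at≡w

  -- A stuck set has 2(a+1) vertices, where a is the size of `A`, hence `W` has a+2. But `μ` embeds
  -- `W` into the triples, of which there are at most a+1.
  two-colouring : ∀ P → 2 * count (edges P) ≤ count P → Colouring P 2
  two-colouring = colour (λ P → 2 * count (edges P) ≤ count P) hereditary unstick
    where
    hereditary : ∀ P x → 2 * count (edges P) ≤ count P → Fresh P x → x ∈ edges P ⊎ Independent P →
                 2 * count (edges (P ⊝ x)) ≤ count (P ⊝ x)
    hereditary P x few fresh (inj₂ none)
      rewrite count-∅ {P = edges (P ⊝ x)} (λ v v∈ → none v (edges-⊆ (P ⊝ x) P (λ _ → proj₁ ∘ ⊝⁻ P) v v∈)) = z≤n
    hereditary P x few fresh (inj₁ x∈) = begin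
      2 * count (edges (P ⊝ x))  ≤⟨ *-monoʳ-≤ 2 (count-⊆ (edges (P ⊝ x)) (edges P ⊝ x) λ v v∈ →
                                      ⊝⁺ (edges P) (edges-⊆ (P ⊝ x) P (λ _ → proj₁ ∘ ⊝⁻ P) v v∈)
                                        (proj₂ (⊝⁻ P (edges-self (P ⊝ x) v∈)))) ⟩
      -- Deleting `x` costs one vertex and at least one triple, so the bound even holds with one
      -- vertex to spare.
      2 * m                      ≤⟨ +-monoʳ-≤ m (n≤1+n _) ⟩
      m + suc (m + 0)            ≤⟨ ≤-pred (≤-trans (≤-reflexive (cong (2 *_) (≡-sym (count-⊝ (edges P) x x∈))))
                                      (≤-trans few (≤-reflexive (count-⊝ P x (Fresh.x∈P fresh))))) ⟩
      count (P ⊝ x)              ∎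
      where
      open ≤-Reasoning
      m = count (edges P ⊝ x)
    unstick : ∀ P → 2 * count (edges P) ≤ count P → Stuck P 2 → Colouring P 2
    unstick P few s = contradiction size (<⇒≢ (subst (_< 2 * suc a) (≡-sym size-W) (begin-strict
      a + count W           ≤⟨ +-monoʳ-≤ a (*-cancelˡ-≤ 2 (≤-trans (*-monoʳ-≤ 2 W≤) (≤-trans few (≤-reflexive size)))) ⟩
      a + suc a             <⟨ ≤-refl ⟩
      suc a + suc a         ≡⟨ cong (suc a +_) (+-identityʳ (suc a)) ⟨
      2 * suc a             ∎)))
      where
      open Stuckness s
      open ≤-Reasoning
      a = count A
      W≤ : count W ≤ count (edges P)
      W≤ = count-inj W (edges P) μ (λ _ → μ-edges-P) μ-injective

  -- The three vertices of a triple are distinct, so two values cannot cover them.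
  avoid-two : ∀ {v} → v ∈ E → ∀ a b → ∃ λ t → at v t ≢ a × at v t ≢ b
  avoid-two {v} v∈E a b = decidable-stable (any? λ t → ¬? (at v t ≟ a) ×-dec ¬? (at v t ≟ b)) λ none →
    let covered : ∀ t → at v t ≡ a ⊎ at v t ≡ b
        covered t = by-cases (at v t ≟ a) inj₁ λ ≢a →
          inj₂ (decidable-stable (at v t ≟ b) λ ≢b → none (t , ≢a , ≢b))
        i , j , i<j , e = Fin.pigeonhole (s≤s (s≤s (s≤s z≤n))) (λ t → side (covered t))
    in Fin.<⇒≢ i<j (at-injective v v∈E (meet (covered i) (covered j) e))
    where
    side : ∀ {t} → at v t ≡ a ⊎ at v t ≡ b → Fin 2
    side = [ const zero , const (suc zero) ]′
    meet : ∀ {s t} (p : at v s ≡ a ⊎ at v s ≡ b) (q : at v t ≡ a ⊎ at v t ≡ b) →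
           side p ≡ side q → at v s ≡ at v t
    meet (inj₁ p) (inj₁ q) _ = trans p (≡-sym q)
    meet (inj₂ p) (inj₂ q) _ = trans p (≡-sym q)

  -- An equitable colouring of the `k * q` remaining vertices has classes of size exactly `q`, the
  -- size of `I`, so the enlarged colouring is equitable again.
  module AddClass {k q} (P I : Sub N) (I⊆P : I ⊆ P) (I-independent : Independent I) (size-I : count I ≡ q)
                  (size-J : count (P ∖ (_∈? I)) ≡ k * q) (c : Colouring (P ∖ (_∈? I)) k) where
    open Colouring c renaming (f to g; proper to g-proper; equitable to g-equitable)
    open AddColour P I I⊆P g

    sizes : ∀ i → count (class P h i) ≡ q
    sizes zero = trans size-zero size-I
    sizes (suc i) = trans (size-suc i)
      (≤-antisym (equitable-≤ {P = J} g-equitable q (≤-reflexive size-J) i)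
                 (equitable-≥ {P = J} g-equitable q (≤-reflexive (≡-sym size-J)) i))

    colouring : Colouring P (suc k)
    colouring = record
      { f = h
      ; proper = λ
          { zero v v∈    → I-independent v (edges-⊆ (class P h zero) I class-zero v v∈)
          ; (suc i) v v∈ → g-proper i v (edges-⊆ (class P h (suc i)) (class J g i) (class-suc i) v v∈) }
      ; equitable = constant⇒equitable {P = P} sizes
      }

  -- Resolving stuck sets for three colours

  module Unstick {P} (s : Stuck P 3) where
    open Stuckness s

    a = count A

    -- The vertex of W to which the triple of v is charged.  When the triple misses W the value v
    -- is junk, but harmless: only the fibres of σ are counted.
    σ : Fin N → Fin N
    σ v with any? (λ t → at v t ∈? W)
    ... | yes (t , _) = at v t
    ... | no _ = v

    σ-spec : ∀ {v} → ∃ (λ t → at v t ∈ W) → σ v ∈ W × ∃ λ t → σ v ≡ at v t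
    σ-spec {v} some with any? (λ t → at v t ∈? W)
    ... | yes (t , t∈) = t∈ , t , refl
    ... | no none = contradiction some none

    -- The triple of `μ w` meets `W` in `w` only, so there is no other vertex to charge.
    σ-μ : ∀ {w} → w ∈ W → σ (μ w) ≡ w
    σ-μ {w} w∈ =
      let t , at≡w = μ-contains w∈
          σ∈W , u , σ≡ = σ-spec (t , subst (_∈ W) (≡-sym at≡w) w∈)
      in [ (λ ∈A → contradiction (subst (_∈ A) (≡-sym σ≡) ∈A) (proj₂ (W⁻ σ∈W))) , trans σ≡ ]′ (μ-vertex w∈ u)

    main? : ∀ v → Dec (∃ λ w → w ∈ W × μ w ≡ v)
    main? v = any? λ w → (w ∈? W) ×-dec (μ w ≟ v)

    -- All vertices of `P` outside the image of `μ`, whether they own a triple or not. As `μ` is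
    -- injective on `W`, the bound `a` is then just the difference of the sizes of `P` and `W`.
    others : Sub N
    others = P ∖ main?

    others≤a : count others ≤ a
    others≤a = +-cancelʳ-≤ (count W) (count others) a (begin
      count others + count W            ≤⟨ +-monoʳ-≤ (count others) (count-inj W (P ∩ main?) μ
                                             (λ w w∈ → ∩⁺ P main? (edges-self P (μ-edges-P w∈)) (w , w∈ , refl))
                                             μ-injective) ⟩
      count others + count (P ∩ main?)  ≡⟨ +-comm (count others) _ ⟩
      count (P ∩ main?) + count others  ≡⟨ count-split P main? ⟨
      count P                           ≡⟨ size-W ⟩
      a + count W                       ∎)
      where open ≤-Reasoning

    dirty? : ∀ w → Dec (∃ λ v → v ∈ others × σ v ≡ w)
    dirty? w = any? λ v → (v ∈? others) ×-dec (σ v ≟ w)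

    clean : Sub N
    clean = W ∖ dirty?

    -- Each dirty vertex is the `σ`-value of some vertex in `others`, and distinct dirty vertices
    -- need distinct ones.
    dirty≤a : count (W ∩ dirty?) ≤ a
    dirty≤a =
      let φ , φ-spec = choice (W ∩ dirty?) λ w w∈ → proj₂ (∩⁻ W dirty? w∈)
      in ≤-trans (count-inj (W ∩ dirty?) others φ (λ w w∈ → proj₁ (φ-spec w w∈))
           λ v w v∈ w∈ e → trans (≡-sym (proj₂ (φ-spec v v∈))) (trans (cong σ e) (proj₂ (φ-spec w w∈))))
         others≤a

    -- `W` has 2a+3 vertices, at most a of them dirty.
    a<clean : a < count clean
    a<clean = ≰⇒> λ clean≤a → contradiction size (<⇒≢ (begin-strict
      count P                                    ≡⟨ size-W ⟩
      a + count W                                ≡⟨ cong (a +_) (count-split W dirty?) ⟩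
      a + (count (W ∩ dirty?) + count clean)     ≤⟨ +-monoʳ-≤ a (+-mono-≤ dirty≤a clean≤a) ⟩
      a + (a + a)                                ≡⟨ cong (λ z → a + (a + z)) (+-identityʳ a) ⟨
      3 * a                                      <⟨ *-monoʳ-< 3 (n<1+n a) ⟩
      3 * suc a                                  ∎))
      where open ≤-Reasoning

    clean⁻ : ∀ {w} → w ∈ clean → w ∈ W × (∀ v → v ∈ P → σ v ≡ w → v ≡ μ w)
    clean⁻ {w} w∈ = w∈W , only
      where
      w∈W = proj₁ (∖⁻ W dirty? w∈)
      only : ∀ v → v ∈ P → σ v ≡ w → v ≡ μ w
      only v v∈ σ≡ with main? v
      ... | no ¬main = contradiction (v , ∖⁺ P main? v∈ ¬main , σ≡) (proj₂ (∖⁻ W dirty? w∈))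
      ... | yes (u , u∈ , refl) = cong μ (trans (≡-sym (σ-μ u∈)) σ≡)

    A-vertex : ∀ w → w ∈ clean → ∃ λ u → u ∈ A × ∃ λ t → at (μ w) t ≡ u
    A-vertex w w∈ =
      let w∈W = proj₁ (clean⁻ w∈)
          -- Excluding `w` twice suffices: any further vertex of the triple lies in `A`.
          t , ≢w , _ = avoid-two (μ∈E w∈W) w w
      in at (μ w) t , [ id , (λ e → contradiction e ≢w) ]′ (μ-vertex w∈W t) , t , refl

    module Exchange {w₁ w₂ u} (w₁∈ : w₁ ∈ clean) (w₂∈ : w₂ ∈ clean) (w₁≢w₂ : w₁ ≢ w₂) (u∈A : u ∈ A)
                    (in₁ : ∃ λ t → at (μ w₁) t ≡ u) (in₂ : ∃ λ t → at (μ w₂) t ≡ u) where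

      w∉A : ∀ {w} → w ∈ clean → w ∉ A
      w∉A w∈ = proj₂ (W⁻ (proj₁ (clean⁻ w∈)))

      I J : Sub N
      I = A ⊝ u ⊕ w₁ ⊕ w₂
      J = P ∖ (_∈? I)

      I⁻ : ∀ {v} → v ∈ I → (v ∈ A × v ≢ u) ⊎ v ≡ w₁ ⊎ v ≡ w₂
      I⁻ v∈ with ⊕⁻ (A ⊝ u ⊕ w₁) v∈
      ... | inj₂ e = inj₂ (inj₂ e)
      ... | inj₁ v∈′ with ⊕⁻ (A ⊝ u) v∈′
      ...   | inj₂ e = inj₂ (inj₁ e)
      ...   | inj₁ v∈″ = inj₁ (⊝⁻ A v∈″)

      A∖u⊆I : ∀ {v} → v ∈ A → v ≢ u → v ∈ I
      A∖u⊆I v∈ v≢u = ⊕⁺ (A ⊝ u ⊕ w₁) (inj₁ (⊕⁺ (A ⊝ u) (inj₁ (⊝⁺ A v∈ v≢u))))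

      u∉I : u ∉ I
      u∉I u∈ with I⁻ u∈
      ... | inj₁ (_ , u≢u)    = u≢u refl
      ... | inj₂ (inj₁ refl) = w∉A w₁∈ u∈A
      ... | inj₂ (inj₂ refl) = w∉A w₂∈ u∈A

      I⊆P : I ⊆ P
      I⊆P v v∈ with I⁻ v∈
      ... | inj₁ (∈A , _)    = A⊆P v ∈A
      ... | inj₂ (inj₁ refl) = proj₁ (W⁻ (proj₁ (clean⁻ w₁∈)))
      ... | inj₂ (inj₂ refl) = proj₁ (W⁻ (proj₁ (clean⁻ w₂∈)))

      size-I : count I ≡ suc a
      size-I = begin
        count I                   ≡⟨ count-⊕ (A ⊝ u ⊕ w₁) w₂ (λ w₂∈′ →
                                       [ (λ p → w∉A w₂∈ (proj₁ (⊝⁻ A p))) , (λ e → w₁≢w₂ (≡-sym e)) ]′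
                                         (⊕⁻ (A ⊝ u) w₂∈′)) ⟩
        suc (count (A ⊝ u ⊕ w₁))  ≡⟨ cong suc (count-⊕ (A ⊝ u) w₁ λ p → w∉A w₁∈ (proj₁ (⊝⁻ A p))) ⟩
        suc (suc (count (A ⊝ u))) ≡⟨ cong suc (count-⊝ A u u∈A) ⟨
        suc a                     ∎
        where open ≡-Reasoning

      size-J : count J ≡ 2 * suc a
      size-J = +-cancelˡ-≡ (suc a) (count J) (2 * suc a) (begin
        suc a + count J    ≡⟨ cong (_+ count J) size-I ⟨
        count I + count J  ≡⟨ count-difference P I I⊆P ⟨
        count P            ≡⟨ size ⟩
        3 * suc a          ∎)
        where open ≡-Reasoning

      -- A triple inside `I` leaves `A`, hence is charged to a vertex of `W` in `I`, that is, to
      -- `w₁` or `w₂`. These are clean, so the triple is that of `μ w₁` or `μ w₂`; but both contain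
      -- `u`, which is not in `I`.
      I-independent : Independent I
      I-independent v v∈ =
        let v∈E , all = edges⁻ I v∈
            t , t∉A = leaves-A v∈E
            σ∈W , r , σ≡ = σ-spec (t , ∖⁺ P (_∈? A) (I⊆P _ (all t)) t∉A)
        in [ (λ (∈A , _) → proj₂ (W⁻ σ∈W) (subst (_∈ A) (≡-sym σ≡) ∈A))
           , [ (λ e → hits w₁∈ in₁ (trans σ≡ e)) , (λ e → hits w₂∈ in₂ (trans σ≡ e)) ]′ ]′ (I⁻ (all r))
        where
        hits : ∀ {w} → w ∈ clean → ∃ (λ t → at (μ w) t ≡ u) → σ v ≢ w
        hits w∈ (t , at≡u) σ≡ with proj₂ (clean⁻ w∈) v (I⊆P v (edges-self I v∈)) σ≡
        ... | refl = u∉I (subst (_∈ I) at≡u (proj₂ (edges⁻ I v∈) t))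

      -- The triple of `μ w` has a vertex other than `w` and `u`. It lies in `A` and therefore in
      -- `I`, so the triple is not contained in `J`.
      J-edges : edges J ⊆ others
      J-edges v v∈ = ∖⁺ P main? (proj₁ (∖⁻ P (_∈? I) (edges-self J v∈))) not-main
        where
        not-main : ¬ ∃ λ w → w ∈ W × μ w ≡ v
        not-main (w , w∈ , refl) =
          let t , ≢w , ≢u = avoid-two (μ∈E w∈) w u
          in proj₂ (∖⁻ P (_∈? I) (proj₂ (edges⁻ J v∈) t))
               (A∖u⊆I ([ id , (λ e → contradiction e ≢w) ]′ (μ-vertex w∈ t)) ≢u)

      split-J : Colouring J 2
      split-J = two-colouring J (begin
        2 * count (edges J)  ≤⟨ *-monoʳ-≤ 2 (≤-trans (count-⊆ (edges J) others J-edges) others≤a) ⟩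
        2 * a                ≤⟨ *-monoʳ-≤ 2 (n≤1+n a) ⟩
        2 * suc a            ≡⟨ size-J ⟨
        count J              ∎)
        where open ≤-Reasoning

      colouring : Colouring P 3
      colouring = AddClass.colouring P I I⊆P I-independent size-I size-J split-J

    colouring : Colouring P 3
    colouring =
      let π , π-spec = choice clean A-vertex
          w₁ , w₂ , w₁∈ , w₂∈ , w₁≢w₂ , e =
            pigeonhole clean A π (λ w w∈ → proj₁ (π-spec w w∈)) a<clean
          u∈A , in₁ = π-spec w₁ w₁∈
          _ , in₂ = π-spec w₂ w₂∈
      in Exchange.colouring w₁∈ w₂∈ w₁≢w₂ u∈A in₁ (subst (λ u → ∃ λ t → at (μ w₂) t ≡ u) (≡-sym e) in₂)

  opaque

    three-colouring : ∀ P → Colouring P 3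
    three-colouring P = colour (const ⊤) (λ _ _ _ _ _ → tt) (λ _ _ → Unstick.colouring) P tt

-- Degenerate graphs

back : (G : Graph) → (Fin (n G) → ℕ) → Sub (n G) → Fin (n G) → Sub (n G)
back G rank P v = P ∩ (λ u → (adj G v u Bool.≟ true) ×-dec (rank u <? rank v))

module _ (G : Graph) (rank : Fin (n G) → ℕ) (P : Sub (n G)) where

  back⁺ : ∀ {u v} → u ∈ P → adj G v u ≡ true → rank u < rank v → u ∈ back G rank P v
  back⁺ {v = v} p e l = ∩⁺ P (λ u → (adj G v u Bool.≟ true) ×-dec (rank u <? rank v)) p (e , l)

  back⁻ : ∀ {u v} → u ∈ back G rank P v → u ∈ P × adj G v u ≡ true × rank u < rank v
  back⁻ {v = v} = ∩⁻ P (λ u → (adj G v u Bool.≟ true) ×-dec (rank u <? rank v))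

BackDegree≤ : (G : Graph) → (Fin (n G) → ℕ) → ℕ → Sub (n G) → Set
BackDegree≤ G rank d P = ∀ v → v ∈ P → count (back G rank P v) ≤ d

induced : (G : Graph) → Sub (n G) → Subgraph G
induced G P = record
  { S = P
  ; F = λ u v → ⌊ F? u v ⌋
  ; F-sym = λ u v → isYes-cong (F? u v) (F? v u) (swap u v) (swap v u)
  ; F⊆E = λ u v e → proj₂ (proj₂ (isYes⁻ (F? u v) e))
  ; F⊆S = λ u v e → proj₁ (isYes⁻ (F? u v) e)
  }
  where
  F? : ∀ u v → Dec (u ∈ P × v ∈ P × adj G u v ≡ true)
  F? u v = (u ∈? P) ×-dec (v ∈? P) ×-dec (adj G u v Bool.≟ true)
  swap : ∀ u v → u ∈ P × v ∈ P × adj G u v ≡ true → v ∈ P × u ∈ P × adj G v u ≡ true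
  swap u v (p , q , e) = q , p , trans (Graph.sym G v u) e

-- `below` keeps the rank `s` free for the vertex that is added next.
record Ordering (G : Graph) (d s : ℕ) (P : Sub (n G)) : Set where
  field
    rank     : Fin (n G) → ℕ
    below    : ∀ v → v ∈ P → rank v < s
    distinct : ∀ u v → u ∈ P → v ∈ P → adj G u v ≡ true → rank u ≢ rank v
    bounded  : BackDegree≤ G rank d P

-- Degeneracy, applied to the subgraph induced by `P`, gives a vertex `x` of degree at most `d`. The
-- rest is ordered by induction and `x` is put last.
ordering : ∀ {d} G → Degenerate d G → ∀ s P → count P ≡ s → Ordering G d s P
ordering G deg zero P P# = record
  { rank = const 0
  ; below = λ v v∈ → contradiction v∈ (empty v)
  ; distinct = λ u v u∈ _ _ → contradiction u∈ (empty u)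
  ; bounded = λ v v∈ → contradiction v∈ (empty v)
  }
  where
  empty : ∀ v → v ∉ P
  empty v v∈ with trans (≡-sym P#) (count-⊝ P v v∈)
  ... | ()
ordering {d} G deg (suc s) P P# with deg (induced G P) (nonempty P (subst (0 <_) (≡-sym P#) (s≤s z≤n)))
... | x , x∈ , deg≤ = record { rank = rank ; below = below ; distinct = distinct ; bounded = bounded }
  where
  module O = Ordering (ordering {d} G deg s (P ⊝ x) (cong pred (trans (≡-sym (count-⊝ P x x∈)) P#)))
  rank : Fin (n G) → ℕ
  rank = updateAt O.rank x (const s)
  rank-x : rank x ≡ s
  rank-x = updateAt-updates x O.rank
  rank-other : ∀ v → v ≢ x → rank v ≡ O.rank v
  rank-other v = updateAt-minimal v x O.rank
  rank<s : ∀ v → v ∈ P → v ≢ x → rank v < s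
  rank<s v v∈ v≢x = subst (_< s) (≡-sym (rank-other v v≢x)) (O.below v (⊝⁺ P v∈ v≢x))
  below : ∀ v → v ∈ P → rank v < suc s
  below v v∈ = by-cases (v ≟ x) (λ { refl → ≤-reflexive (cong suc rank-x) })
    λ v≢x → m<n⇒m<1+n (rank<s v v∈ v≢x)
  distinct : ∀ u v → u ∈ P → v ∈ P → adj G u v ≡ true → rank u ≢ rank v
  distinct u v u∈ v∈ e with u ≟ x | v ≟ x
  ... | yes refl | yes refl = contradiction (trans (≡-sym e) (irref G u)) λ ()
  ... | yes refl | no v≢x   = λ r → <⇒≢ (rank<s v v∈ v≢x) (trans (≡-sym r) rank-x)
  ... | no u≢x   | yes refl = λ r → <⇒≢ (rank<s u u∈ u≢x) (trans r rank-x)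
  ... | no u≢x   | no v≢x   = λ r → O.distinct u v (⊝⁺ P u∈ u≢x) (⊝⁺ P v∈ v≢x) e
                                (trans (≡-sym (rank-other u u≢x)) (trans r (rank-other v v≢x)))
  bounded : BackDegree≤ G rank d P
  bounded v v∈ with v ≟ x
  ... | yes refl = ≤-trans (count-⊆ (back G rank P v) (λ u → F (induced G P) v u) λ u u∈ →
        let p , e , _ = back⁻ G rank P u∈
        in isYes⁺ ((v ∈? P) ×-dec (u ∈? P) ×-dec (adj G v u Bool.≟ true)) (v∈ , p , e)) deg≤
  ... | no v≢x = ≤-trans (count-⊆ (back G rank P v) (back G O.rank (P ⊝ x) v) λ u u∈ →
        let p , e , u<v = back⁻ G rank P u∈
            -- The last vertex `x` is an earlier neighbour of no vertex.
            u≢x = λ u≡x → <-asym u<v (subst (rank v <_) (≡-sym (trans (cong rank u≡x) rank-x)) (rank<s v v∈ v≢x))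
        in back⁺ G O.rank (P ⊝ x) (⊝⁺ P p u≢x) e
             (subst₂ _<_ (rank-other u u≢x) (rank-other v v≢x) u<v))
      (O.bounded v (⊝⁺ P v∈ v≢x))

-- Cycles and earlier neighbours

cycle-neighbours : ∀ {G P} (C : CycleIn G P) → let open CycleIn C in ∀ i →
                   ∃₂ λ j k → j ≢ k × adj G (c i) (c j) ≡ true × adj G (c i) (c k) ≡ true
cycle-neighbours {G} C zero = suc zero , fromℕ (suc (suc m)) , (λ ()) , step zero , trans (Graph.sym G _ _) close
  where open CycleIn C
cycle-neighbours {G} C (suc i) with view i
... | ‵fromℕ = zero , inject₁ (fromℕ (suc m)) , (λ ()) , close , trans (Graph.sym G _ _) (step (fromℕ (suc m)))
  where open CycleIn C
... | ‵inject₁ j = suc (suc j) , inject₁ (inject₁ j) , (λ e → differ (cong toℕ e)) , step (suc j) ,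
                   trans (Graph.sym G _ _) (step (inject₁ j))
  where
  open CycleIn C
  differ : toℕ (suc (suc j)) ≢ toℕ (inject₁ (inject₁ j))
  differ rewrite Fin.toℕ-inject₁ (inject₁ j) | Fin.toℕ-inject₁ j = λ e → <⇒≢ (m≤n⇒m≤1+n ≤-refl) (≡-sym e)

module Ranked (G : Graph) (rank : Fin (n G) → ℕ)
              (distinct : ∀ u v → adj G u v ≡ true → rank u ≢ rank v) where

  -- On a cycle, both neighbours of the vertex of highest rank are earlier than it, contrary to the
  -- bound 1.
  forest : ∀ {P} → BackDegree≤ G rank 1 P → InducesForest G P
  forest {P} bounded C =
    let i , _ , max = argmax (λ i → rank (c i)) (const true) (zero , refl)
        j , k , j≢k , ij , ik = cycle-neighbours C i
        lower : ∀ {j} → adj G (c i) (c j) ≡ true → c j ∈ back G rank P (c i)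
        lower {j} e = back⁺ G rank P (inP j) e (≤∧≢⇒< (max j refl) λ r → distinct (c i) (c j) e (≡-sym r))
    in contradiction (≤-trans (two≤count (back G rank P (c i)) (λ e → j≢k (inj e)) (lower ij) (lower ik))
                              (bounded (c i) (inP i)))
                     λ { (s≤s ()) }
    where open CycleIn C

  back-mono : ∀ P Q → P ⊆ Q → ∀ v → back G rank P v ⊆ back G rank Q v
  back-mono P Q P⊆Q v u u∈ = let p , e , l = back⁻ G rank P u∈ in back⁺ G rank Q (P⊆Q u p) e l

  bounded-⊆ : ∀ {d} P Q → P ⊆ Q → BackDegree≤ G rank d Q → BackDegree≤ G rank d P
  bounded-⊆ P Q P⊆Q bounded v v∈ =
    ≤-trans (count-⊆ (back G rank P v) (back G rank Q v) (back-mono P Q P⊆Q v)) (bounded v (P⊆Q v v∈))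

  -- Splitting into three parts of smaller back-degree

  module ThreeParts (P : Sub (n G)) where

    E : Sub (n G)
    E = const true ∩ (λ v → 2 ≤? count (back G rank P v))

    E⁻ : ∀ {v} → v ∈ E → 2 ≤ count (back G rank P v)
    E⁻ v∈ = proj₂ (∩⁻ (const true) (λ v → 2 ≤? count (back G rank P v)) v∈)

    firsts : ∃ λ (α : Fin (n G) → Fin (n G)) → ∀ v → v ∈ E →
             ∃ λ w → α v ≢ w × α v ∈ back G rank P v × w ∈ back G rank P v
    firsts = choice E λ v v∈ → two-elements (back G rank P v) (E⁻ v∈)

    α : Fin (n G) → Fin (n G)
    α = proj₁ firsts

    seconds : ∃ λ (β : Fin (n G) → Fin (n G)) → ∀ v → v ∈ E →
              α v ≢ β v × α v ∈ back G rank P v × β v ∈ back G rank P v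
    seconds = choice E (proj₂ firsts)

    β : Fin (n G) → Fin (n G)
    β = proj₁ seconds

    at : Fin (n G) → Fin 3 → Fin (n G)
    at v zero             = v
    at v (suc zero)       = α v
    at v (suc (suc zero)) = β v

    at-back : ∀ v → v ∈ E → ∀ t → at v (suc t) ∈ back G rank P v
    at-back v v∈ zero       = proj₁ (proj₂ (proj₂ seconds v v∈))
    at-back v v∈ (suc zero) = proj₂ (proj₂ (proj₂ seconds v v∈))

    at-earlier : ∀ v → v ∈ E → ∀ t → rank (at v (suc t)) < rank v
    at-earlier v v∈ t = proj₂ (proj₂ (back⁻ G rank P (at-back v v∈ t)))

    at-injective : ∀ v → v ∈ E → ∀ {s t} → at v s ≡ at v t → s ≡ t
    at-injective v v∈ {zero} {zero} e = refl
    at-injective v v∈ {zero} {suc t} e = contradiction (cong rank (≡-sym e)) (<⇒≢ (at-earlier v v∈ t))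
    at-injective v v∈ {suc s} {zero} e = contradiction (cong rank e) (<⇒≢ (at-earlier v v∈ s))
    at-injective v v∈ {suc zero} {suc zero} e = refl
    at-injective v v∈ {suc zero} {suc (suc zero)} e = contradiction e (proj₁ (proj₂ seconds v v∈))
    at-injective v v∈ {suc (suc zero)} {suc zero} e = contradiction (≡-sym e) (proj₁ (proj₂ seconds v v∈))
    at-injective v v∈ {suc (suc zero)} {suc (suc zero)} e = refl

    open Triples E at rank (λ _ → refl) at-injective at-earlier

    -- The triple of `v` is not contained in `T` although `v` is, so one of the two chosen earlier
    -- neighbours lies outside `T`.
    loses-neighbour : ∀ {T} → T ⊆ P → Independent T → ∀ v → v ∈ E → v ∈ T →
                      count (back G rank T v) < count (back G rank P v)
    loses-neighbour {T} T⊆P independent v v∈E v∈T with any? (λ t → ¬? (at v t ∈? T))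
    ... | yes (zero , v∉T) = contradiction v∈T v∉T
    ... | yes (suc t , ∉T) = count-⊂ (back G rank T v) (back G rank P v) (at v (suc t))
      (back-mono T P T⊆P v) (at-back v v∈E t) λ u∈ → ∉T (proj₁ (back⁻ G rank T u∈))
    ... | no none = contradiction
      (edges⁺ T v∈E λ t → decidable-stable (at v t ∈? T) λ ∉T → none (t , ∉T)) (independent v)

    opaque

      three-parts : ∀ d → BackDegree≤ G rank (suc (suc d)) P →
                    ∃ λ (g : Fin (n G) → Fin 3) → Equitable P g × (∀ i → BackDegree≤ G rank (suc d) (class P g i))
      three-parts d bounded = f , equitable , part-bounded
        where
        open Colouring (three-colouring P)
        part-bounded : ∀ i → BackDegree≤ G rank (suc d) (class P f i)
        part-bounded i v v∈ with 2 ≤? count (back G rank P v)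
        ... | yes 2≤ = ≤-pred (≤-trans
                (loses-neighbour (λ _ → proj₁ ∘ class⁻) (proper i) v
                  (∩⁺ (const true) (λ v → 2 ≤? count (back G rank P v)) refl 2≤) v∈)
                (bounded v (proj₁ (class⁻ v∈))))
        -- A vertex that owns no triple has at most one earlier neighbour, within the bound `suc d`
        -- anyway.
        ... | no 2≰ = ≤-trans (count-⊆ (back G rank (class P f i) v) (back G rank P v)
                (back-mono (class P f i) P (λ _ → proj₁ ∘ class⁻) v))
                (≤-trans (≤-pred (≰⇒> 2≰)) (s≤s z≤n))

  -- Forests are recorded by back-degree at most 1 with respect to the one fixed `rank`. This passes
  -- to subsets, and `forest` turns it into acyclicity.
  Partition : Sub (n G) → ℕ → Set
  Partition P k = ∃ λ (f : Fin (n G) → Fin k) → Equitable P f × (∀ i → BackDegree≤ G rank 1 (class P f i))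

  power-partition : ∀ d P → BackDegree≤ G rank (suc d) P → Partition P (3 ^ d)
  power-partition zero P bounded = const zero , equi ,
    λ i → bounded-⊆ (class P (const zero) i) P (λ _ → proj₁ ∘ class⁻) bounded
    where
    equi : Equitable P (const zero)
    equi zero zero = n≤1+n _
  power-partition (suc d) P bounded = h , equi , h-bounded
    where
    parts = ThreeParts.three-parts P d bounded
    g = proj₁ parts
    g-equitable = proj₁ (proj₂ parts)
    pieces : ∀ i → Partition (class P g i) (3 ^ d)
    pieces i = power-partition d (class P g i) (proj₂ (proj₂ parts) i)
    f : ∀ i → Fin (n G) → Fin (3 ^ d)
    f i = proj₁ (pieces i)
    h : Fin (n G) → Fin (3 ^ suc d)
    h v = combine (g v) (f (g v) v)
    class-h : ∀ i j → class P h (combine i j) ⊆ class (class P g i) (f i) j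
    class-h i j v v∈ with class⁻ {f = h} v∈
    ... | p , e with combine-injective (g v) (f (g v) v) i j e
    ...   | refl , e′ = class⁺ (class⁺ p refl) e′
    class-h⁻¹ : ∀ i j → class (class P g i) (f i) j ⊆ class P h (combine i j)
    class-h⁻¹ i j v v∈ with class⁻ {f = f i} v∈
    ... | q , e′ with class⁻ {P = P} q
    ...   | p , refl = class⁺ p (cong (combine (g v)) e′)
    size : ∀ i j → count (class P h (combine i j)) ≡ count (class (class P g i) (f i) j)
    size i j = count-cong (class P h (combine i j)) (class (class P g i) (f i) j) (class-h i j) (class-h⁻¹ i j)
    h-bounded : ∀ i → BackDegree≤ G rank 1 (class P h i)
    h-bounded ij with combine-surjective {3} {3 ^ d} ij
    ... | i , j , refl = bounded-⊆ (class P h (combine i j)) (class (class P g i) (f i) j) (class-h i j)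
                           (proj₂ (proj₂ (pieces i)) j)
    equi : Equitable P h
    equi ij ij′ with combine-surjective {3} {3 ^ d} ij | combine-surjective {3} {3 ^ d} ij′
    ... | i , j , refl | i′ , j′ , refl rewrite size i j | size i′ j′ =
      -- Class `i′` has fewer than 3^d (y+1) vertices, since otherwise all its pieces, including
      -- `j′`, would have at least y+1. So class `i` has at most 3^d (y+1) vertices, and its pieces
      -- at most y+1 each.
      equitable-≤ {P = class P g i} (proj₁ (proj₂ (pieces i))) (suc y)
        (≤-trans (g-equitable i i′) (≰⇒> λ le → <⇒≱ (n<1+n y)
          (equitable-≥ {P = class P g i′} (proj₁ (proj₂ (pieces i′))) (suc y) le j′))) j
      where y = count (class (class P g i′) (f i′) j′)

  -- One part with the rounded-down average size `q` is cut out of a forest of the 3^d-partition.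
  -- The rest has between `k * q` and `k * suc q` vertices, so the parts found by induction have `q`
  -- or `suc q` vertices each.
  partition : ∀ e d P → BackDegree≤ G rank (suc d) P → Partition P (e + 3 ^ d)
  partition zero    d P bounded = power-partition d P bounded
  partition (suc e) d P bounded = h , equi , h-bounded
    where
    k = e + 3 ^ d
    q = count P / suc k
    forests = power-partition d P bounded
    i₀ : Fin (3 ^ d)
    i₀ = Fin.fromℕ< (m^n>0 3 d)
    -- There are at most `suc k` forests, so equitability makes each of them at least as large as
    -- the rounded-down average over `suc k` parts.
    large : q ≤ count (class P (proj₁ forests) i₀)
    large = equitable-≥ {P = P} (proj₁ (proj₂ forests)) q
      (≤-trans (*-monoˡ-≤ q (m≤n⇒m≤1+n (m≤n+m (3 ^ d) e)))
               (≤-trans (≤-reflexive (*-comm (suc k) q)) (m/n*n≤m (count P) (suc k)))) i₀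
    shrunk = shrink (class P (proj₁ forests) i₀) (count (class P (proj₁ forests) i₀) ∸ q) q
               (≡-sym (m∸n+n≡m large))
    T = proj₁ shrunk
    T⊆P : T ⊆ P
    T⊆P v v∈ = proj₁ (class⁻ (proj₁ (proj₂ shrunk) v v∈))
    remaining = partition e d (P ∖ (_∈? T)) (bounded-⊆ (P ∖ (_∈? T)) P (λ _ → proj₁ ∘ ∖⁻ P (_∈? T)) bounded)
    open AddColour P T T⊆P (proj₁ remaining)
    size-P : count P ≡ q + count J
    size-P = trans (count-difference P T T⊆P) (cong (_+ count J) (proj₂ (proj₂ shrunk)))
    lower : k * q ≤ count J
    lower = +-cancelˡ-≤ q (k * q) (count J) (begin
      suc k * q              ≡⟨ *-comm (suc k) q ⟩
      q * suc k              ≤⟨ m/n*n≤m (count P) (suc k) ⟩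
      count P                ≡⟨ size-P ⟩
      q + count J            ∎)
      where open ≤-Reasoning
    upper : count J ≤ k * suc q
    upper = +-cancelˡ-≤ q (count J) (k * suc q) (begin
      q + count J                    ≡⟨ size-P ⟨
      count P                        ≡⟨ m≡m%n+[m/n]*n (count P) (suc k) ⟩
      -- The remainder modulo `suc k` is at most `k`, one extra vertex for each of the `k` remaining
      -- parts.
      count P % suc k + q * suc k    ≤⟨ +-monoˡ-≤ (q * suc k) (≤-pred (m%n<n (count P) (suc k))) ⟩
      k + q * suc k                  ≡⟨ cong (k +_) (*-comm q (suc k)) ⟩
      k + (q + k * q)                ≡⟨ +-assoc k q (k * q) ⟨
      k + q + k * q                  ≡⟨ cong (_+ k * q) (+-comm k q) ⟩
      q + k + k * q                  ≡⟨ +-assoc q k (k * q) ⟩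
      q + (k + k * q)                ≡⟨ cong (q +_) (*-suc k q) ⟨
      q + k * suc q                  ∎)
      where open ≤-Reasoning
    ≥q : ∀ i → q ≤ count (class P h i)
    ≥q zero    = ≤-reflexive (≡-sym (trans size-zero (proj₂ (proj₂ shrunk))))
    ≥q (suc i) = ≤-trans (equitable-≥ {P = J} (proj₁ (proj₂ remaining)) q lower i) (≤-reflexive (≡-sym (size-suc i)))
    ≤1+q : ∀ i → count (class P h i) ≤ suc q
    ≤1+q zero    = ≤-trans (≤-reflexive (trans size-zero (proj₂ (proj₂ shrunk)))) (n≤1+n q)
    ≤1+q (suc i) = ≤-trans (≤-reflexive (size-suc i)) (equitable-≤ {P = J} (proj₁ (proj₂ remaining)) (suc q) upper i)
    equi : Equitable P h
    equi i j = ≤-trans (≤1+q i) (s≤s (≥q j))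
    h-bounded : ∀ i → BackDegree≤ G rank 1 (class P h i)
    h-bounded zero    = bounded-⊆ (class P h zero) (class P (proj₁ forests) i₀)
      (λ v v∈ → proj₁ (proj₂ shrunk) v (class-zero v v∈)) (proj₂ (proj₂ forests) i₀)
    h-bounded (suc i) = bounded-⊆ (class P h (suc i)) (class J (proj₁ remaining) i) (class-suc i)
      (proj₂ (proj₂ remaining) i)

theorem9 : (d k : ℕ) → 1 ≤ d → 3 ^ (d ∸ 1) ≤ k →
    (G : Graph) → Degenerate d G → EquitableForestPartition G k
theorem9 (suc d) k _ 3^d≤k G deg = f , equi , forests
  where
  full : Sub (n G)
  full = const true
  open Ordering (ordering {suc d} G deg (count full) full refl)
  open Ranked G rank (λ u v → distinct u v refl refl)
  result : Partition full k
  result = subst (Partition full) (m∸n+n≡m 3^d≤k) (partition (k ∸ 3 ^ d) d full bounded)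
  f : Fin (n G) → Fin k
  f = proj₁ result
  part-⊆ : ∀ i → part {G} f i ⊆ class full f i
  part-⊆ i v v∈ = class⁺ refl (isYes⁻ (f v ≟ i) v∈)
  ⊆-part : ∀ i → class full f i ⊆ part {G} f i
  ⊆-part i v v∈ = isYes⁺ (f v ≟ i) (proj₂ (class⁻ {P = full} v∈))
  size : ∀ i → count (part {G} f i) ≡ count (class full f i)
  size i = count-cong (part {G} f i) (class full f i) (part-⊆ i) (⊆-part i)
  equi : ∀ i j → count (part {G} f i) ≤ count (part {G} f j) + 1
  equi i j rewrite size i | size j | +-comm (count (class full f j)) 1 = proj₁ (proj₂ result) i j
  forests : ∀ i → InducesForest G (part {G} f i)
  forests i = forest (bounded-⊆ (part {G} f i) (class full f i) (part-⊆ i) (proj₂ (proj₂ result) i))
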